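{- Let $n\ge 1$ and $\pi\in\mathfrak{S}_n$. Then $\mathfrak{S}(H_R(\pi))$ equals the lower Bruhat interval $[\mathrm{id},\pi]=\{\sigma\in\mathfrak{S}_n:\sigma\le\pi\}$ in $\mathfrak{S}_n$ if and only if $\pi$ avoids the patterns $4231$, $35142$, $42513$ and $351624$.
   Context: Permutations $\pi\in\mathfrak{S}_n$ are identified with rook configurations (sets of cells, no two in the same row or column) on an $n\times n$ grid: there is a rook in cell $(i,j)$ (row $i$, column $j$) iff $\pi(i)=j$. A zero-one $n\times n$ matrix $A$ is identified with the set of its one-entries; $A$ covers a rook configuration if every rook lies on a one-entry of $A$. For such $A$, $\mathfrak{S}(A)$ is the set of $\pi\in\mathfrak{S}_n$ with $A_{i,\pi(i)}=1$ for all $i$. A zero-one matrix $\lambda$ is a right-aligned (resp. left-aligned) Ferrers matrix if every one-entry has one-entries directly to its right (resp. left) and directly above it, whenever those entries exist. A right-aligned (resp. left-aligned) skew Ferrers matrix is a difference $\lambda-\mu$ where $\lambda,\mu$ are right-aligned (resp. left-aligned) Ferrers matrices of the same size with $\mu\le\lambda$ entrywise. The right hull $H_R(\pi)$ is the smallest right-aligned skew Ferrers matrix covering $\pi$. The Bruhat order on $\mathfrak{S}_n$ is the usual (strong) Bruhat order; equivalently $\sigma\le\rho$ iff $|\{a\le i:\sigma(a)\ge j\}|\le|\{a\le i:\rho(a)\ge j\}|$ for all $i,j\in[n]$. Pattern avoidance is in the usual sense. -}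

module Defs where

open import Data.Nat using (ℕ; suc; _≤_; _<_; _≤ᵇ_)
open import Data.Fin using (Fin; toℕ)
open import Data.Fin.Permutation using (Permutation′; _⟨$⟩ʳ_)
open import Data.Bool using (Bool; true; false; _∧_; not; if_then_else_)
open import Data.List using (List; map; allFin)
open import Data.Nat.ListAction using (sum)
open import Data.Vec using (Vec; lookup; _∷_; [])
open import Data.Product using (Σ; _×_; ∃)
open import Function.Bundles using (_⇔_)
open import Relation.Binary.PropositionalEquality using (_≡_)
open import Relation.Nullary using (¬_)

-- Zero-one n×n matrices: A i j = true iff (i,j) is a one-entry.
-- Row index i (row 0 is the top row), column index j (column 0 is leftmost).
Matrix : ℕ → Set
Matrix n = Fin n → Fin n → Bool

_⊑_ : ∀ {n} → Matrix n → Matrix n → Set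
A ⊑ B = ∀ i j → A i j ≡ true → B i j ≡ true

Covers : ∀ {n} → Matrix n → Permutation′ n → Set
Covers A π = ∀ i → A i (π ⟨$⟩ʳ i) ≡ true

IsRightFerrers : ∀ {n} → Matrix n → Set
IsRightFerrers {n} A =
  (∀ (i j j' : Fin n) → toℕ j' ≡ suc (toℕ j) → A i j ≡ true → A i j' ≡ true)
  × (∀ (i i' j : Fin n) → toℕ i ≡ suc (toℕ i') → A i j ≡ true → A i' j ≡ true)

IsRightSkewFerrers : ∀ {n} → Matrix n → Set
IsRightSkewFerrers {n} A =
  Σ (Matrix n) λ lam → Σ (Matrix n) λ mu →
    IsRightFerrers lam × IsRightFerrers mu × mu ⊑ lam
    × (∀ i j → A i j ≡ (lam i j ∧ not (mu i j)))

IsRightHull : ∀ {n} → Permutation′ n → Matrix n → Set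
IsRightHull {n} π H =
  IsRightSkewFerrers H × Covers H π
  × (∀ (B : Matrix n) → IsRightSkewFerrers B → Covers B π → H ⊑ B)

rankCount : ∀ {n} → Permutation′ n → Fin n → Fin n → ℕ
rankCount {n} σ i j =
  sum (map (λ a → if (toℕ a ≤ᵇ toℕ i) ∧ (toℕ j ≤ᵇ toℕ (σ ⟨$⟩ʳ a)) then 1 else 0)
           (allFin n))

_≤B_ : ∀ {n} → Permutation′ n → Permutation′ n → Set
σ ≤B ρ = ∀ i j → rankCount σ i j ≤ rankCount ρ i j

Contains : ∀ {n k} → Permutation′ n → Vec ℕ k → Set
Contains {n} {k} π p =
  Σ (Fin k → Fin n) λ f →
    (∀ (a b : Fin k) → toℕ a < toℕ b → toℕ (f a) < toℕ (f b))
    × (∀ (a b : Fin k) → (toℕ (π ⟨$⟩ʳ f a) < toℕ (π ⟨$⟩ʳ f b)) ⇔ (lookup p a < lookup p b))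

Avoids : ∀ {n k} → Permutation′ n → Vec ℕ k → Set
Avoids π p = ¬ Contains π p

p4231 : Vec ℕ 4
p4231 = 4 ∷ 2 ∷ 3 ∷ 1 ∷ []

p35142 : Vec ℕ 5
p35142 = 3 ∷ 5 ∷ 1 ∷ 4 ∷ 2 ∷ []

p42513 : Vec ℕ 5
p42513 = 4 ∷ 2 ∷ 5 ∷ 1 ∷ 3 ∷ []

p351624 : Vec ℕ 6
p351624 = 3 ∷ 5 ∷ 1 ∷ 6 ∷ 2 ∷ 4 ∷ []

{-# OPTIONS --safe #-}
-- A cell lies in the right hull of π iff some rook of π is weakly south-west and some rook weakly north-east of it;
-- comparing rank counts, the hull therefore covers every σ ≤ π.
--
-- Suppose the hull covers σ but σ has more rooks than π north-east of some corner.  Rows and columns at the corner whose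
-- π-rook lies in the NE quadrant can be removed from it without losing the excess, and afterwards (on the inverse
-- permutations) so can those of the SW quadrant, which has the same excess.  When nothing can be removed, the rooks of
-- the rows and columns adjacent to the corner, with one NE and one SW rook of π, form one of the four patterns.
--
-- Conversely, the rooks of a pattern occurrence can be rearranged inside the hull so that some NE count increases.
module Submission where

open import Defs
open import Data.Bool using (Bool; true; false; T; _∧_; not; if_then_else_)
open import Data.Bool.Properties using (∧-comm; ∧-conicalˡ; ∧-conicalʳ; not-involutive; T-∧)
open import Data.Empty using (⊥; ⊥-elim)
open import Data.Fin using (Fin; zero; suc; toℕ; fromℕ<; #_)
open import Data.Fin.Permutation using (Permutation′; permutation; flip; transpose; _∘ₚ_; _⟨$⟩ʳ_; _⟨$⟩ˡ_; inverseˡ; inverseʳ)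
open import Data.Fin.Properties using (toℕ-injective; toℕ<n; toℕ-fromℕ<; any?; all?)
import Data.Fin.Properties as Fin
open import Data.List using (tabulate)
open import Data.List.Properties using (map-tabulate)
open import Data.Nat using (ℕ; zero; suc; _+_; _≤_; _<_; _<ᵇ_; _≤ᵇ_; _≤?_; _<?_; _≟_; z≤n; s≤s)
open import Data.Nat.ListAction using () renaming (sum to sumList)
open import Data.Nat.Properties hiding (_≟_; _≤?_; _<?_)
open import Data.Product using (_×_; _,_; ∃; proj₁; proj₂)
open import Data.Sum using (_⊎_; inj₁; inj₂)
open import Data.Vec using (Vec; []; _∷_; lookup)
import Data.Vec as Vec
open import Data.Vec.Relation.Unary.Linked using (Linked; [-]; _∷_)
open import Data.Vec.Relation.Unary.Linked.Properties using (lookup⁺)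
open import Data.Vec.Properties using (lookup-map)
open import Function using (_∘_)
open import Function.Bundles using (_⇔_; mk⇔; module Equivalence)
open import Relation.Binary.Definitions using (tri<; tri≈; tri>)
open import Relation.Binary.PropositionalEquality
open import Relation.Nullary using (¬_; Dec; yes; no; does; contradiction)
open import Relation.Nullary.Decidable using (dec-true; dec-false; from-yes; _×-dec_; _→-dec_; decidable-stable; map′)
open import Algebra.Properties.CommutativeMonoid.Sum +-0-commutativeMonoid using (sum; sum-permute; sum-cong-≗; ∑-distrib-+)

private
  variable
    n k : ℕ

col : Permutation′ n → Fin n → ℕ
col π a = toℕ (π ⟨$⟩ʳ a)

col-injective : (π : Permutation′ n) {a b : Fin n} → col π a ≡ col π b → a ≡ b
col-injective π eq =
  trans (sym (inverseˡ π)) (trans (cong (π ⟨$⟩ˡ_) (toℕ-injective eq)) (inverseˡ π))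

-- The right hull as a set of cells

WeaklySW WeaklyNE : Permutation′ n → Fin n → Fin n → Set
WeaklySW π i j = ∃ λ c → toℕ i ≤ toℕ c × col π c ≤ toℕ j
WeaklyNE π i j = ∃ λ c → toℕ c ≤ toℕ i × toℕ j ≤ col π c

weaklySW? : (π : Permutation′ n) → ∀ i j → Dec (WeaklySW π i j)
weaklySW? π i j = any? λ c → (toℕ i ≤? toℕ c) ×-dec (col π c ≤? toℕ j)

weaklyNE? : (π : Permutation′ n) → ∀ i j → Dec (WeaklyNE π i j)
weaklyNE? π i j = any? λ c → (toℕ c ≤? toℕ i) ×-dec (toℕ j ≤? col π c)

dec-true⁻ : {A : Set} (a? : Dec A) → does a? ≡ true → A
dec-true⁻ (yes a) _ = a

not-does⁻ : {A : Set} (a? : Dec A) → not (does a?) ≡ true → ¬ A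
not-does⁻ (no ¬a) _ = ¬a

-- `IsRightFerrers` constrains adjacent cells only. With `R` an implication between entries, single
-- steps compose to closure over any distance; for rows the implication runs backwards, since
-- closure is upwards.
step⇒≤ : (R : Fin n → Fin n → Set) → (∀ {i} → R i i) → (∀ {i j k} → R i j → R j k → R i k) →
  (∀ i j → toℕ j ≡ suc (toℕ i) → R i j) → ∀ i j → toℕ i ≤ toℕ j → R i j
step⇒≤ {n} R rfl tr step i j i≤j = go (toℕ j) j refl i≤j
  where
  go : ∀ m (j : Fin n) → toℕ j ≡ m → toℕ i ≤ m → R i j
  go m j eq i≤m with m≤n⇒m<n∨m≡n i≤m
  ... | inj₂ i≡m = subst (R i) (toℕ-injective (trans i≡m (sym eq))) rfl
  go (suc m) j eq _ | inj₁ (s≤s i≤m) =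
    tr (go m j⁻ (toℕ-fromℕ< m<n) i≤m) (step j⁻ j (trans eq (cong suc (sym (toℕ-fromℕ< m<n)))))
    where
    m<n : m < n
    m<n = <-trans (n<1+n m) (subst (_< n) eq (toℕ<n j))
    j⁻ = fromℕ< m<n

ferrers-closed : {A : Matrix n} → IsRightFerrers A → ∀ {i i' j j'} →
  toℕ i' ≤ toℕ i → toℕ j ≤ toℕ j' → A i j ≡ true → A i' j' ≡ true
ferrers-closed {A = A} (right , up) {i} {i'} {j} {j'} i'≤i j≤j' =
  step⇒≤ (λ a b → A b j' ≡ true → A a j' ≡ true) (λ x → x) (λ f g → f ∘ g) (λ a b → up b a j') i' i i'≤i
  ∘ step⇒≤ (λ a b → A i a ≡ true → A i b ≡ true) (λ x → x) (λ f g → g ∘ f) (right i) j j' j≤j'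

closed⇒ferrers : {A : Matrix n} → (∀ {i i' j j'} → toℕ i' ≤ toℕ i → toℕ j ≤ toℕ j' → A i j ≡ true → A i' j' ≡ true) →
  IsRightFerrers A
closed⇒ferrers closed =
  (λ i j j' eq → closed ≤-refl (≤-trans (n≤1+n _) (≤-reflexive (sym eq)))) ,
  (λ i i' j eq → closed (≤-trans (n≤1+n _) (≤-reflexive (sym eq))) ≤-refl)

-- The two Ferrers matrices whose difference is the hull.
lower upper : Permutation′ n → Matrix n
lower π i j = does (weaklySW? π i j)
upper π i j = lower π i j ∧ not (does (weaklyNE? π i j))

lower-closed : ∀ (π : Permutation′ n) {i i' j j'} → toℕ i' ≤ toℕ i → toℕ j ≤ toℕ j' →
  lower π i j ≡ true → lower π i' j' ≡ true
lower-closed π {i} {i'} {j} {j'} i'≤i j≤j' h with dec-true⁻ (weaklySW? π i j) h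
... | c , i≤c , c≤j = dec-true (weaklySW? π i' j') (c , ≤-trans i'≤i i≤c , ≤-trans c≤j j≤j')

upper-closed : ∀ (π : Permutation′ n) {i i' j j'} → toℕ i' ≤ toℕ i → toℕ j ≤ toℕ j' →
  upper π i j ≡ true → upper π i' j' ≡ true
upper-closed π {i} {i'} {j} {j'} i'≤i j≤j' h = cong₂ _∧_
  (lower-closed π i'≤i j≤j' (∧-conicalˡ _ _ h))
  (cong not (dec-false (weaklyNE? π i' j') λ (c , c≤i' , j'≤c) →
    not-does⁻ (weaklyNE? π i j) (∧-conicalʳ (lower π i j) _ h) (c , ≤-trans c≤i' i'≤i , ≤-trans j≤j' j'≤c)))

-- Minimality is applied to the difference of `lower π` and `upper π`, which covers `π` because each
-- rook is weakly south-west and north-east of itself. The conjunct `lower` inside `upper` secures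
-- `mu ⊑ lam` and leaves in the difference exactly the cells with both kinds of rooks.
hull⇒rooks : (π : Permutation′ n) {H : Matrix n} → IsRightHull π H →
  ∀ i j → H i j ≡ true → WeaklySW π i j × WeaklyNE π i j
hull⇒rooks π (_ , _ , least) i j h =
  dec-true⁻ (weaklySW? π i j) (∧-conicalˡ _ _ b) ,
  decidable-stable (weaklyNE? π i j) λ ¬ne → absurd (lower π i j) (dec-false (weaklyNE? π i j) ¬ne) b
  where
  B : Matrix _
  B i j = lower π i j ∧ not (upper π i j)
  covers : Covers B π
  covers i rewrite dec-true (weaklySW? π i (π ⟨$⟩ʳ i)) (i , ≤-refl , ≤-refl)
                 | dec-true (weaklyNE? π i (π ⟨$⟩ʳ i)) (i , ≤-refl , ≤-refl) = refl
  b : B i j ≡ true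
  b = least B (lower π , upper π , closed⇒ferrers (lower-closed π) , closed⇒ferrers (upper-closed π) ,
      (λ i j → ∧-conicalˡ _ _) , (λ _ _ → refl)) covers i j h
  absurd : ∀ x {y} → y ≡ false → x ∧ not (x ∧ not y) ≡ true → ⊥
  absurd true refl ()
  absurd false _ ()

-- The south-west rook lies in `lam`, which is closed towards the north-east, so `lam` contains the
-- cell. If `mu` contained it too, `mu` would contain the north-east rook, which the hull covers.
rooks⇒hull : (π : Permutation′ n) {H : Matrix n} → IsRightHull π H →
  ∀ {i j} → WeaklySW π i j → WeaklyNE π i j → H i j ≡ true
rooks⇒hull π ((lam , mu , Flam , Fmu , _ , H≡) , covers , _) {i} {j} (c , i≤c , c≤j) (d , d≤i , j≤d) =
  trans (H≡ i j) (combine (ferrers-closed Flam i≤c c≤j (∧-conicalˡ _ _ (cell c))) mu-false)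
  where
  cell : ∀ a → lam a (π ⟨$⟩ʳ a) ∧ not (mu a (π ⟨$⟩ʳ a)) ≡ true
  cell a = trans (sym (H≡ a _)) (covers a)
  mu-false : ¬ mu i j ≡ true
  mu-false m with mu d (π ⟨$⟩ʳ d) | ferrers-closed Fmu d≤i j≤d m | ∧-conicalʳ (lam d (π ⟨$⟩ʳ d)) _ (cell d)
  ... | true  | _  | ()
  ... | false | () | _
  combine : ∀ {x y} → x ≡ true → ¬ y ≡ true → x ∧ not y ≡ true
  combine {y = true}  refl ¬y = contradiction refl ¬y
  combine {y = false} refl _  = refl

-- Counting rooks

indicator : Bool → ℕ
indicator b = if b then 1 else 0

sum-mono-≤ : {f g : Fin n → ℕ} → (∀ a → f a ≤ g a) → sum f ≤ sum g
sum-mono-≤ {zero}  f≤g = z≤n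
sum-mono-≤ {suc n} f≤g = +-mono-≤ (f≤g zero) (sum-mono-≤ (f≤g ∘ suc))

sum-mono-< : {f g : Fin n → ℕ} → (∀ a → f a ≤ g a) → ∀ a → f a < g a → sum f < sum g
sum-mono-< f≤g zero    f<g = +-mono-<-≤ f<g (sum-mono-≤ (f≤g ∘ suc))
sum-mono-< f≤g (suc a) f<g = +-mono-≤-< (f≤g zero) (sum-mono-< (f≤g ∘ suc) a f<g)

sum-positive : (f : Fin n → ℕ) → 0 < sum f → ∃ λ a → 0 < f a
sum-positive {suc n} f 0<s with f zero in eq
... | suc _ = zero , subst (0 <_) (sym eq) (s≤s z≤n)
... | zero with sum-positive (f ∘ suc) 0<s
... | a , 0<fa = suc a , 0<fa

sumList-tabulate : (f : Fin n → ℕ) → sumList (tabulate f) ≡ sum f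
sumList-tabulate {zero}  f = refl
sumList-tabulate {suc n} f = cong (f zero +_) (sumList-tabulate (f ∘ suc))

entry : (Fin n → Bool) → (Fin n → Bool) → Permutation′ n → Fin n → ℕ
entry R C σ a = indicator (R a ∧ C (σ ⟨$⟩ʳ a))

rooks : (Fin n → Bool) → (Fin n → Bool) → Permutation′ n → ℕ
rooks R C σ = sum (entry R C σ)

rooks-cong : {R R' C C' : Fin n → Bool} → R ≗ R' → C ≗ C' → ∀ σ → rooks R C σ ≡ rooks R' C' σ
rooks-cong R≗ C≗ σ = sum-cong-≗ λ a → cong₂ (λ x y → indicator (x ∧ y)) (R≗ a) (C≗ _)

rooks-flip : ∀ (R C : Fin n → Bool) σ → rooks R C σ ≡ rooks C R (flip σ)
rooks-flip R C σ = sym (trans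
  (sum-permute (λ b → indicator (C b ∧ R (σ ⟨$⟩ˡ b))) σ)
  (sum-cong-≗ λ a → cong indicator (trans (cong (λ x → C (σ ⟨$⟩ʳ a) ∧ R x) (inverseˡ σ)) (∧-comm (C (σ ⟨$⟩ʳ a)) (R a)))))

-- Both sides count the rows that are in `R` or have their rook outside `C`. Hence the counts in
-- opposite quadrants differ by an amount independent of `σ`.
rooks-complement : ∀ (R C : Fin n → Bool) σ →
  rooks R C σ + sum (indicator ∘ not ∘ C) ≡ sum (indicator ∘ R) + rooks (not ∘ R) (not ∘ C) σ
rooks-complement R C σ = begin
  rooks R C σ + sum (indicator ∘ not ∘ C)
    ≡⟨ cong (rooks R C σ +_) (sum-permute (indicator ∘ not ∘ C) σ) ⟩
  rooks R C σ + sum (λ a → indicator (not (C (σ ⟨$⟩ʳ a))))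
    ≡⟨ ∑-distrib-+ (entry R C σ) (λ a → indicator (not (C (σ ⟨$⟩ʳ a)))) ⟨
  sum (λ a → entry R C σ a + indicator (not (C (σ ⟨$⟩ʳ a))))
    ≡⟨ sum-cong-≗ (λ a → pointwise (R a) (C (σ ⟨$⟩ʳ a))) ⟩
  sum (λ a → indicator (R a) + entry (not ∘ R) (not ∘ C) σ a)
    ≡⟨ ∑-distrib-+ (indicator ∘ R) (entry (not ∘ R) (not ∘ C) σ) ⟩
  sum (indicator ∘ R) + rooks (not ∘ R) (not ∘ C) σ ∎
  where
  open ≡-Reasoning
  pointwise : ∀ r c → indicator (r ∧ c) + indicator (not c) ≡ indicator r + indicator (not r ∧ not c)
  pointwise true  true  = refl
  pointwise true  false = refl
  pointwise false true  = refl
  pointwise false false = refl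

-- Each dropped row costs `π` exactly one rook and `σ` at most one, so the excess of `σ` survives.
-- Adding the counts crosswise avoids subtraction.
rooks-drop-rows : {R R' C : Fin n → Bool} (σ π : Permutation′ n) →
  (∀ a → T (R' a) → T (R a)) → (∀ a → T (R a) → ¬ T (R' a) → T (C (π ⟨$⟩ʳ a))) →
  rooks R C π < rooks R C σ → rooks R' C π < rooks R' C σ
rooks-drop-rows {R = R} {R'} {C} σ π R'⊆R full π<σ = +-cancelʳ-< (rooks R C π) _ _ (begin-strict
  rooks R' C π + rooks R C π   ≡⟨ +-comm (rooks R' C π) _ ⟩
  rooks R C π + rooks R' C π   <⟨ +-monoˡ-< _ π<σ ⟩
  rooks R C σ + rooks R' C π   ≡⟨ ∑-distrib-+ (entry R C σ) (entry R' C π) ⟨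
  sum (λ a → entry R C σ a + entry R' C π a)
    ≤⟨ sum-mono-≤ (λ a → pointwise (R a) (R' a) (C (σ ⟨$⟩ʳ a)) (C (π ⟨$⟩ʳ a)) (R'⊆R a) (full a)) ⟩
  sum (λ a → entry R' C σ a + entry R C π a)
    ≡⟨ ∑-distrib-+ (entry R' C σ) (entry R C π) ⟩
  rooks R' C σ + rooks R C π   ∎)
  where
  open ≤-Reasoning
  pointwise : ∀ r r' s p → (T r' → T r) → (T r → ¬ T r' → T p) →
    indicator (r ∧ s) + indicator (r' ∧ p) ≤ indicator (r' ∧ s) + indicator (r ∧ p)
  pointwise true  true  s     p     _ _ = ≤-refl
  pointwise true  false true  true  _ _ = ≤-refl
  pointwise true  false false p     _ _ = z≤n
  pointwise true  false true  false _ f = ⊥-elim (f _ λ ())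
  pointwise false true  s     p     g _ = ⊥-elim (g _)
  pointwise false false s     p     _ _ = ≤-refl

rooks-drop-cols : {R C C' : Fin n → Bool} (σ π : Permutation′ n) →
  (∀ b → T (C' b) → T (C b)) → (∀ b → T (C b) → ¬ T (C' b) → T (R (π ⟨$⟩ˡ b))) →
  rooks R C π < rooks R C σ → rooks R C' π < rooks R C' σ
rooks-drop-cols {R = R} {C} {C'} σ π C'⊆C full π<σ =
  subst₂ _<_ (sym (rooks-flip R C' π)) (sym (rooks-flip R C' σ))
    (rooks-drop-rows {R = C} {C'} {R} (flip σ) (flip π) C'⊆C full
      (subst₂ _<_ (rooks-flip R C π) (rooks-flip R C σ) π<σ))

below : ℕ → Fin n → Bool
below m a = toℕ a <ᵇ m

below⁺ : ∀ {m} {a : Fin n} → toℕ a < m → T (below m a)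
below⁺ = <⇒<ᵇ

below⁻ : ∀ {m} {a : Fin n} → T (below m a) → toℕ a < m
below⁻ = <ᵇ⇒< _ _

T-not⁺ : ∀ {b} → ¬ T b → T (not b)
T-not⁺ {true}  ¬t = ¬t _
T-not⁺ {false} _  = _

T-not⁻ : ∀ {b} → T (not b) → ¬ T b
T-not⁻ {false} _ ()

notBelow⁺ : ∀ {m} {a : Fin n} → m ≤ toℕ a → T (not (below m a))
notBelow⁺ m≤a = T-not⁺ λ t → <⇒≱ (below⁻ t) m≤a

notBelow⁻ : ∀ {m} {a : Fin n} → T (not (below m a)) → m ≤ toℕ a
notBelow⁻ t = ≮⇒≥ (T-not⁻ t ∘ below⁺)

-- The bound `I` is exclusive and `J` inclusive, so `(I , J)` is a corner between cells, and its
-- south-west quadrant is the north-east quadrant of `flip σ` at `(J , I)`.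
northEast : Permutation′ n → ℕ → ℕ → ℕ
northEast σ I J = rooks (below I) (not ∘ below J) σ

Exceeds : (σ π : Permutation′ n) → ℕ → ℕ → Set
Exceeds σ π I J = northEast π I J < northEast σ I J

rankCount≡northEast : (σ : Permutation′ n) → ∀ i j → rankCount σ i j ≡ northEast σ (suc (toℕ i)) (toℕ j)
rankCount≡northEast {n} σ i j = trans (cong sumList (map-tabulate (λ a → a) cell))
  (trans (sumList-tabulate cell) (sum-cong-≗ λ a → cong indicator
    (cong₂ _∧_ (≤ᵇ≡<ᵇ (toℕ a) (toℕ i)) (≤ᵇ≡not (toℕ j) (col σ a)))))
  where
  cell : Fin n → ℕ
  cell a = indicator ((toℕ a ≤ᵇ toℕ i) ∧ (toℕ j ≤ᵇ col σ a))
  ≤ᵇ≡<ᵇ : ∀ a b → (a ≤ᵇ b) ≡ (a <ᵇ suc b)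
  ≤ᵇ≡<ᵇ zero    b = refl
  ≤ᵇ≡<ᵇ (suc a) b = refl
  ≤ᵇ≡not : ∀ a b → (a ≤ᵇ b) ≡ not (b <ᵇ a)
  ≤ᵇ≡not zero    b       = refl
  ≤ᵇ≡not (suc a) zero    = refl
  ≤ᵇ≡not (suc a) (suc b) = trans (sym (≤ᵇ≡<ᵇ a b)) (≤ᵇ≡not a b)

T⇒indicator : ∀ {b} → T b → 0 < indicator b
T⇒indicator {true} _ = s≤s z≤n

indicator⇒T : ∀ {b} → 0 < indicator b → T b
indicator⇒T {true} _ = _

northEast-positive⁻ : (σ : Permutation′ n) → ∀ I J → 0 < northEast σ I J → ∃ λ a → toℕ a < I × J ≤ col σ a
northEast-positive⁻ σ I J 0<s with sum-positive (λ a → indicator (below I a ∧ not (below J (σ ⟨$⟩ʳ a)))) 0<s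
... | a , p with Equivalence.to T-∧ (indicator⇒T p)
... | t , u = a , below⁻ t , notBelow⁻ u

northEast-positive⁺ : (σ : Permutation′ n) → ∀ {I J} a → toℕ a < I → J ≤ col σ a → 0 < northEast σ I J
northEast-positive⁺ σ {I} {J} a a<I J≤a = ≤-<-trans z≤n
  (sum-mono-< (λ _ → z≤n) a (T⇒indicator (Equivalence.from T-∧ (below⁺ {m = I} a<I , notBelow⁺ {m = J} J≤a))))

exceeds⇒rook : (σ π : Permutation′ n) → ∀ I J → Exceeds σ π I J → ∃ λ a → toℕ a < I × J ≤ col σ a
exceeds⇒rook σ π I J e = northEast-positive⁻ σ I J (≤-<-trans z≤n e)

-- Transposition exchanges the south-west and north-east quadrants, and the excess of σ over π is the same in both.
exceeds-flip : (σ π : Permutation′ n) → ∀ I J → Exceeds σ π I J → Exceeds (flip σ) (flip π) J I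
exceeds-flip σ π I J e = subst₂ _<_ (southWest π) (southWest σ)
  (+-cancelˡ-< (sum (indicator ∘ R)) _ _
    (subst₂ _<_ (rooks-complement R C π) (rooks-complement R C σ) (+-monoˡ-< _ e)))
  where
  R C : Fin _ → Bool
  R = below I
  C = not ∘ below J
  southWest : ∀ ρ → rooks (not ∘ R) (not ∘ C) ρ ≡ northEast (flip ρ) J I
  southWest ρ = trans
    (rooks-cong {R = not ∘ R} {C = not ∘ C} (λ _ → refl) (λ b → not-involutive (below J b)) ρ)
    (rooks-flip (not ∘ R) (below J) ρ)

exceeds⇒≰B : (σ π : Permutation′ n) → ∀ I J → I ≤ n → Exceeds σ π I J → ¬ σ ≤B π
exceeds⇒≰B {n} σ π I J I≤n e σ≤π with exceeds⇒rook σ π I J e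
-- The excess provides a rook of `σ` in the quadrant, so there is at least one row and `J < n`: the
-- corner belongs to an actual cell, as `rankCount` requires.
exceeds⇒≰B {n} σ π (suc I) J I<n e σ≤π | a , _ , J≤a = <⇒≱ e
  (subst₂ (λ x y → northEast σ (suc x) y ≤ northEast π (suc x) y) (toℕ-fromℕ< I<n) (toℕ-fromℕ< J<n)
    (subst₂ _≤_ (rankCount≡northEast σ i j) (rankCount≡northEast π i j) (σ≤π i j)))
  where
  J<n : J < n
  J<n = ≤-<-trans J≤a (toℕ<n (σ ⟨$⟩ʳ a))
  i = fromℕ< I<n
  j = fromℕ< J<n

transfer-rook : (σ π : Permutation′ n) → ∀ I J → ¬ Exceeds σ π I J →
  ∀ a → toℕ a < I → J ≤ col σ a → ∃ λ c → toℕ c < I × J ≤ col π c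
transfer-rook σ π I J ¬e a a<I J≤σa =
  northEast-positive⁻ π I J (<-≤-trans (northEast-positive⁺ σ a a<I J≤σa) (≮⇒≥ ¬e))

-- The quadrant cornered at a rook of `σ` contains that rook, so by `σ ≤B π` it also contains a rook
-- of `π`. The two quadrants yield the two rooks that place the cell in the hull.
≤B⇒covers : (π : Permutation′ n) {H : Matrix n} → IsRightHull π H → ∀ σ → σ ≤B π → Covers H σ
≤B⇒covers π hull σ σ≤π i = rooks⇒hull π hull sw ne
  where
  s = col σ i
  ne : WeaklyNE π i (σ ⟨$⟩ʳ i)
  ne = let c , c≤i , s≤c = transfer-rook σ π (suc (toℕ i)) s (λ e → exceeds⇒≰B σ π (suc (toℕ i)) s (toℕ<n i) e σ≤π)
                             i ≤-refl ≤-refl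
       in c , ≤-pred c≤i , s≤c
  sw : WeaklySW π i (σ ⟨$⟩ʳ i)
  sw = let b , b≤s , i≤c = transfer-rook (flip σ) (flip π) (suc s) (toℕ i)
             (λ e → exceeds⇒≰B σ π (toℕ i) (suc s) (<⇒≤ (toℕ<n i))
                      (exceeds-flip (flip σ) (flip π) (suc s) (toℕ i) e) σ≤π)
             (σ ⟨$⟩ʳ i) ≤-refl (≤-reflexive (cong toℕ (sym (inverseˡ σ))))
       in π ⟨$⟩ˡ b , i≤c , ≤-trans (≤-reflexive (cong toℕ (inverseʳ π))) (≤-pred b≤s)

-- Moving the corner

-- The corner moves up while the row just above it has its `π`-rook in the quadrant. It stops before
-- the rows run out, because an excess needs a rook of `σ`.
drop-rows : (σ π : Permutation′ n) → ∀ I J → I ≤ n → Exceeds σ π I J →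
  ∃ λ i → toℕ i < I × col π i < J × Exceeds σ π (suc (toℕ i)) J
        × (∀ a → toℕ i < toℕ a → toℕ a < I → J ≤ col π a)
drop-rows σ π zero J _ e with exceeds⇒rook σ π zero J e
... | _ , () , _
drop-rows {n} σ π (suc I) J I<n e with col π (fromℕ< I<n) <? J
... | yes π<J = i , s≤s (≤-reflexive i≡I) , π<J , subst (λ x → Exceeds σ π (suc x) J) (sym i≡I) e
              , λ a i<a a≤I → contradiction (<-≤-trans i<a (≤-pred a≤I)) (<-irrefl i≡I)
  where
  i = fromℕ< I<n
  i≡I = toℕ-fromℕ< I<n
... | no π≮J with drop-rows σ π I J (<⇒≤ I<n)
                    (rooks-drop-rows {R = below (suc I)} {below I} {not ∘ below J} σ π
                      (λ a → below⁺ {m = suc I} ∘ m<n⇒m<1+n ∘ below⁻ {a = a})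
                      (λ a a≤I a≮I → notBelow⁺ (full a (below⁻ a≤I) (≮⇒≥ (a≮I ∘ below⁺)))) e)
  where
  full : ∀ a → toℕ a < suc I → I ≤ toℕ a → J ≤ col π a
  full a (s≤s a≤I) I≤a = subst (λ x → J ≤ col π x)
    (toℕ-injective (trans (toℕ-fromℕ< I<n) (≤-antisym I≤a a≤I))) (≮⇒≥ π≮J)
... | i , i<I , πi<J , e' , removed = i , m<n⇒m<1+n i<I , πi<J , e' , removed'
  where
  removed' : ∀ a → toℕ i < toℕ a → toℕ a < suc I → J ≤ col π a
  removed' a i<a (s≤s a≤I) with m≤n⇒m<n∨m≡n a≤I
  ... | inj₁ a<I = removed a i<a a<I
  ... | inj₂ a≡I = subst (λ x → J ≤ col π x) (toℕ-injective (trans (toℕ-fromℕ< I<n) (sym a≡I))) (≮⇒≥ π≮J)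

-- The analogue of `drop-rows`, with the corner moving right. `fuel` bounds the number of remaining
-- columns; at zero there would be no column for the rook of `σ` that the excess supplies.
drop-cols : (σ π : Permutation′ n) → ∀ fuel I J → n ≤ fuel + J → Exceeds σ π I J →
  ∃ λ j → J ≤ toℕ j × I ≤ col (flip π) j × Exceeds σ π I (toℕ j)
        × (∀ b → J ≤ toℕ b → toℕ b < toℕ j → col (flip π) b < I)
drop-cols {n} σ π fuel I J n≤ e with exceeds⇒rook σ π I J e
... | a₀ , _ , J≤a₀ = go fuel n≤
  where
  J<n : J < n
  J<n = ≤-<-trans J≤a₀ (toℕ<n (σ ⟨$⟩ʳ a₀))
  j = fromℕ< J<n
  j≡J = toℕ-fromℕ< J<n
  go : ∀ fuel → n ≤ fuel + J → ∃ λ j → J ≤ toℕ j × I ≤ col (flip π) j × Exceeds σ π I (toℕ j)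
        × (∀ b → J ≤ toℕ b → toℕ b < toℕ j → col (flip π) b < I)
  go zero n≤J = contradiction J<n (≤⇒≯ n≤J)
  go (suc fuel) n≤ with col (flip π) j <? I
  ... | no π≮I = j , ≤-reflexive (sym j≡J) , ≮⇒≥ π≮I , subst (Exceeds σ π I) (sym j≡J) e
               , λ b J≤b b<j → contradiction (≤-<-trans J≤b b<j) (<-irrefl (sym j≡J))
  ... | yes π<I with drop-cols σ π fuel I (suc J) (≤-trans n≤ (≤-reflexive (sym (+-suc fuel J))))
                       (rooks-drop-cols {R = below I} {not ∘ below J} {not ∘ below (suc J)} σ π
                         (λ b → notBelow⁺ ∘ <⇒≤ ∘ notBelow⁻ {m = suc J})
                         (λ b J≤b J≮b → below⁺ (full b (notBelow⁻ J≤b) (≮⇒≥ (J≮b ∘ notBelow⁺)))) e)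
    where
    full : ∀ b → J ≤ toℕ b → toℕ b ≤ J → col (flip π) b < I
    full b J≤b b≤J = subst (λ x → col (flip π) x < I) (toℕ-injective (trans j≡J (≤-antisym J≤b b≤J))) π<I
  ... | j' , J<j' , I≤j' , e' , removed = j' , <⇒≤ J<j' , I≤j' , e' , removed'
    where
    removed' : ∀ b → J ≤ toℕ b → toℕ b < toℕ j' → col (flip π) b < I
    removed' b J≤b b<j' with m≤n⇒m<n∨m≡n J≤b
    ... | inj₁ J<b = removed b J<b b<j'
    ... | inj₂ J≡b = subst (λ x → col (flip π) x < I) (toℕ-injective (trans j≡J J≡b)) π<I

-- At a shrunk corner every north-east rook of π has a north-west rook below it and a south-east rook to its left.
record ShrunkCorner (σ π : Permutation′ n) (I J : ℕ) : Set where
  field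
    lastRow firstCol : Fin n
    exceeds     : Exceeds σ π (suc (toℕ lastRow)) (toℕ firstCol)
    lastRow-NW  : col π lastRow < toℕ firstCol
    firstCol-SE : toℕ lastRow < col (flip π) firstCol
    NW-kept     : ∀ {a} → toℕ a < I → col π a < J → toℕ a ≤ toℕ lastRow × col π a < toℕ firstCol
    SE-kept     : ∀ {a} → I ≤ toℕ a → J ≤ col π a → toℕ lastRow < toℕ a × toℕ firstCol ≤ col π a

-- Removed rows and columns have their `π`-rooks in the north-east quadrant, so north-west and
-- south-east rooks of the old corner remain such at the new one. This is what later places the
-- rooks bounding the first shrinking relative to the second.
shrink : (σ π : Permutation′ n) → ∀ I J → I ≤ n → Exceeds σ π I J → ShrunkCorner σ π I J
shrink {n} σ π I J I≤n e with drop-rows σ π I J I≤n e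
... | i , i<I , πi<J , e₁ , rows with drop-cols σ π n (suc (toℕ i)) J (m≤m+n n J) e₁
... | j , J≤j , i<πj , e₂ , cols = record
  { lastRow = i ; firstCol = j ; exceeds = e₂
  ; lastRow-NW = <-≤-trans πi<J J≤j ; firstCol-SE = i<πj
  ; NW-kept = λ {a} a<I πa<J → ≮⇒≥ (λ i<a → <⇒≱ πa<J (rows a i<a a<I)) , <-≤-trans πa<J J≤j
  ; SE-kept = λ {a} I≤a J≤πa → <-≤-trans i<I I≤a , ≮⇒≥ λ πa<j →
      <⇒≱ (subst (λ x → toℕ x < suc (toℕ i)) (inverseˡ π) (cols (π ⟨$⟩ʳ a) J≤πa πa<j)) (<-≤-trans i<I I≤a)
  }

-- Pattern occurrences

-- `byValue` lists positions by increasing value: it is the inverse of `p`, whose values start at 1.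
-- An occurrence thus reduces to two chains of consecutive inequalities, and `rank` to an evaluation
-- of `rank?`.
contains : (π : Permutation′ n) (p : Vec ℕ k) (rows : Vec (Fin n) k) (byValue : Vec (Fin k) k) →
  (∀ a → ∃ λ s → lookup byValue s ≡ a × lookup p a ≡ suc (toℕ s)) →
  Linked _<_ (Vec.map toℕ rows) →
  Linked _<_ (Vec.map (λ s → col π (lookup rows s)) byValue) →
  Contains π p
contains {k = k} π p rows byValue rank rows< cols< = f , f-mono , λ a b → mk⇔ (to a b) (from a b)
  where
  f = lookup rows
  f-mono : ∀ a b → toℕ a < toℕ b → toℕ (f a) < toℕ (f b)
  f-mono a b a<b = subst₂ _<_ (lookup-map a toℕ rows) (lookup-map b toℕ rows) (lookup⁺ <-trans rows< a<b)
  value : Fin k → ℕ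
  value s = col π (f (lookup byValue s))
  value-mono : ∀ s t → toℕ s < toℕ t → value s < value t
  value-mono s t s<t = subst₂ _<_ (lookup-map s _ byValue) (lookup-map t _ byValue) (lookup⁺ <-trans cols< s<t)
  from : ∀ a b → lookup p a < lookup p b → col π (f a) < col π (f b)
  from a b pa<pb with rank a | rank b
  ... | s , refl , ps | t , refl , pt = value-mono s t (≤-pred (subst₂ _<_ ps pt pa<pb))
  to : ∀ a b → col π (f a) < col π (f b) → lookup p a < lookup p b
  to a b va<vb with rank a | rank b
  ... | s , refl , ps | t , refl , pt = subst₂ _<_ (sym ps) (sym pt) (s≤s (≰⇒> λ t≤s → <⇒≱ va<vb (mono-≤ t s t≤s)))
    where
    mono-≤ : ∀ t s → toℕ t ≤ toℕ s → value t ≤ value s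
    mono-≤ t s t≤s with m≤n⇒m<n∨m≡n t≤s
    ... | inj₁ t<s = <⇒≤ (value-mono t s t<s)
    ... | inj₂ t≡s = ≤-reflexive (cong value (toℕ-injective t≡s))

rank? : (p : Vec ℕ k) (byValue : Vec (Fin k) k) →
  Dec (∀ a → ∃ λ s → lookup byValue s ≡ a × lookup p a ≡ suc (toℕ s))
rank? p byValue = all? λ a → any? λ s → (lookup byValue s Fin.≟ a) ×-dec (lookup p a ≟ suc (toℕ s))

AvoidsAll : Permutation′ n → Set
AvoidsAll π = Avoids π p4231 × Avoids π p35142 × Avoids π p42513 × Avoids π p351624

module _ (π : Permutation′ n) where

  private
    _↓_ _⇢_ : Fin n → Fin n → Set
    a ↓ b = toℕ a < toℕ b
    a ⇢ b = col π a < col π b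

    col-≢ : ∀ {a b} → a ↓ b → ¬ col π a ≡ col π b
    col-≢ a↓b eq = <-irrefl (cong toℕ (col-injective π eq)) a↓b

    row-≢ : ∀ {a b} → a ⇢ b → ¬ toℕ a ≡ toℕ b
    row-≢ a⇢b eq = <-irrefl (cong (col π) (toℕ-injective eq)) a⇢b

  -- N, S are rooks in the NE and SW quadrants, x₁, x₂ in the NW and y₁, y₂ in the SE one.
  -- If one rook can play the roles of both x₁ and x₂, the pattern has a single NW entry, and likewise for SE;
  -- the four combinations are the four patterns.
  quadrants⇒pattern : (N x₁ x₂ y₁ y₂ S : Fin n) →
    x₁ ↓ y₂ → x₂ ↓ y₂ → toℕ y₂ ≤ toℕ y₁ → N ↓ x₁ → y₂ ↓ S →
    col π x₁ ≤ col π x₂ → x₂ ⇢ y₁ → x₂ ⇢ y₂ → y₁ ⇢ N → S ⇢ x₂ →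
    ¬ AvoidsAll π
  quadrants⇒pattern N x₁ x₂ y₁ y₂ S x₁↓y₂ x₂↓y₂ y₂≤y₁ N↓x₁ y₂↓S x₁≤x₂ x₂⇢y₁ x₂⇢y₂ y₁⇢N S⇢x₂
    (no4231 , no35142 , no42513 , no351624) = cases northWest southEast
    where
    SingleNW DoubleNW SingleSE DoubleSE : Set
    SingleNW = ∃ λ x → N ↓ x × x ↓ y₂ × S ⇢ x × col π x ≤ col π x₂
    DoubleNW = x₂ ↓ N × x₁ ⇢ S
    SingleSE = ∃ λ y → y ↓ S × toℕ y₂ ≤ toℕ y × y ⇢ N × x₂ ⇢ y
    DoubleSE = S ↓ y₁ × N ⇢ y₂

    northWest : SingleNW ⊎ DoubleNW
    -- By assumption `x₁` is below `N` and `x₂` is right of `S`. If each lacks the other's property,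
    -- then `N` lies between their rows and `S` between their columns.
    northWest with col π S <? col π x₁ | toℕ N <? toℕ x₂
    ... | yes S⇢x₁ | _        = inj₁ (x₁ , N↓x₁ , x₁↓y₂ , S⇢x₁ , x₁≤x₂)
    ... | no  _    | yes N↓x₂ = inj₁ (x₂ , N↓x₂ , x₂↓y₂ , S⇢x₂ , ≤-refl)
    ... | no S≮x₁  | no N≮x₂  = inj₂
      ( ≤∧≢⇒< (≮⇒≥ N≮x₂) (row-≢ (<-trans x₂⇢y₁ y₁⇢N))
      , ≤∧≢⇒< (≮⇒≥ S≮x₁) (col-≢ (<-trans x₁↓y₂ y₂↓S)))

    southEast : SingleSE ⊎ DoubleSE
    southEast with toℕ y₁ <? toℕ S | col π y₂ <? col π N
    ... | yes y₁↓S | _        = inj₁ (y₁ , y₁↓S , y₂≤y₁ , y₁⇢N , x₂⇢y₁)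
    ... | no  _    | yes y₂⇢N = inj₁ (y₂ , y₂↓S , ≤-refl , y₂⇢N , x₂⇢y₂)
    ... | no y₁≮S  | no y₂≮N  = inj₂
      ( ≤∧≢⇒< (≮⇒≥ y₁≮S) (row-≢ (<-trans S⇢x₂ x₂⇢y₁))
      , ≤∧≢⇒< (≮⇒≥ y₂≮N) (col-≢ (<-trans N↓x₁ x₁↓y₂)))

    cases : SingleNW ⊎ DoubleNW → SingleSE ⊎ DoubleSE → ⊥
    cases (inj₁ (x , N↓x , x↓y₂ , S⇢x , x≤x₂)) (inj₁ (y , y↓S , y₂≤y , y⇢N , x₂⇢y)) = no4231
      (contains π p4231 (N ∷ x ∷ y ∷ S ∷ []) v (from-yes (rank? p4231 v))
        (N↓x ∷ <-≤-trans x↓y₂ y₂≤y ∷ y↓S ∷ [-])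
        (S⇢x ∷ ≤-<-trans x≤x₂ x₂⇢y ∷ y⇢N ∷ [-]))
      where v = # 3 ∷ # 1 ∷ # 2 ∷ # 0 ∷ []
    cases (inj₂ (x₂↓N , x₁⇢S)) (inj₁ (y , y↓S , y₂≤y , y⇢N , x₂⇢y)) = no35142
      (contains π p35142 (x₂ ∷ N ∷ x₁ ∷ y ∷ S ∷ []) v (from-yes (rank? p35142 v))
        (x₂↓N ∷ N↓x₁ ∷ <-≤-trans x₁↓y₂ y₂≤y ∷ y↓S ∷ [-])
        (x₁⇢S ∷ S⇢x₂ ∷ x₂⇢y ∷ y⇢N ∷ [-]))
      where v = # 2 ∷ # 4 ∷ # 0 ∷ # 3 ∷ # 1 ∷ []
    cases (inj₁ (x , N↓x , x↓y₂ , S⇢x , x≤x₂)) (inj₂ (S↓y₁ , N⇢y₂)) = no42513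
      (contains π p42513 (N ∷ x ∷ y₂ ∷ S ∷ y₁ ∷ []) v (from-yes (rank? p42513 v))
        (N↓x ∷ x↓y₂ ∷ y₂↓S ∷ S↓y₁ ∷ [-])
        (S⇢x ∷ ≤-<-trans x≤x₂ x₂⇢y₁ ∷ y₁⇢N ∷ N⇢y₂ ∷ [-]))
      where v = # 3 ∷ # 1 ∷ # 4 ∷ # 0 ∷ # 2 ∷ []
    cases (inj₂ (x₂↓N , x₁⇢S)) (inj₂ (S↓y₁ , N⇢y₂)) = no351624
      (contains π p351624 (x₂ ∷ N ∷ x₁ ∷ y₂ ∷ S ∷ y₁ ∷ []) v (from-yes (rank? p351624 v))
        (x₂↓N ∷ N↓x₁ ∷ x₁↓y₂ ∷ y₂↓S ∷ S↓y₁ ∷ [-])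
        (x₁⇢S ∷ S⇢x₂ ∷ x₂⇢y₁ ∷ y₁⇢N ∷ N⇢y₂ ∷ [-]))
      where v = # 2 ∷ # 4 ∷ # 0 ∷ # 5 ∷ # 1 ∷ # 3 ∷ []

-- The rooks `x₁` and `y₁` of `π` stopped the first shrinking, in the last row and first column of
-- the north-east quadrant; `x₂` and `y₂` stopped the second one. Each quadrant holds a rook of `σ`,
-- which lies in the hull, so `π` has a rook `N` or `S` weakly beyond it.
shrunkCorners⇒pattern : (σ π : Permutation′ n) {H : Matrix n} → IsRightHull π H → Covers H σ →
  ∀ {I J} (c : ShrunkCorner σ π I J) (let open ShrunkCorner c) →
  ShrunkCorner (flip σ) (flip π) (toℕ firstCol) (suc (toℕ lastRow)) → ¬ AvoidsAll π
shrunkCorners⇒pattern σ π hull covers c c' =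
  quadrants⇒pattern π N x₁ x₂ y₁ y₂ S x₁<y₂ x₂<y₂ y₂≤y₁
    -- Here and below, a weak inequality is strict because the other boundary line of the quadrant
    -- separates the two rooks.
    (≤∧≢⇒< N≤x₁ λ eq → <⇒≱ lastRow-NW (subst (λ a → toℕ firstCol ≤ col π a) (toℕ-injective eq) y₁≤N))
    (≤∧≢⇒< y₂≤S λ eq → <⇒≱ SW.firstCol-SE (subst (λ a → col π a ≤ toℕ SW.lastRow) (sym (toℕ-injective eq)) S≤x₂))
    (subst (col π x₁ ≤_) (sym πx₂) x₁≤x₂)
    (subst₂ _<_ (sym πx₂) (sym πy₁) x₂<y₁)
    (subst (_< col π y₂) (sym πx₂) SW.firstCol-SE)
    (subst (_< col π N) (sym πy₁) (≤∧≢⇒< y₁≤N λ eq →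
      <⇒≱ firstCol-SE (subst (λ a → toℕ a ≤ toℕ x₁) (col-injective π (trans (sym eq) (sym πy₁))) N≤x₁)))
    (subst (col π S <_) (sym πx₂) (≤∧≢⇒< S≤x₂ λ eq →
      <⇒≱ x₂<y₂ (subst (λ a → toℕ y₂ ≤ toℕ a) (col-injective π (trans eq (sym πx₂))) y₂≤S)))
  where
  open ShrunkCorner c
  module SW = ShrunkCorner c'
  x₁ = lastRow
  -- `c'` belongs to the inverses: its `lastRow` is a column of `π` and its `firstCol` a row.
  x₂ = π ⟨$⟩ˡ SW.lastRow
  y₁ = π ⟨$⟩ˡ firstCol
  y₂ = SW.firstCol
  πx₂ : col π x₂ ≡ toℕ SW.lastRow
  πx₂ = cong toℕ (inverseʳ π)
  πy₁ : col π y₁ ≡ toℕ firstCol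
  πy₁ = cong toℕ (inverseʳ π)

  row-π⁻¹ : ∀ a → toℕ (π ⟨$⟩ˡ (π ⟨$⟩ʳ a)) ≡ toℕ a
  row-π⁻¹ a = cong toℕ (inverseˡ π)
  x₁-kept : col π x₁ ≤ toℕ SW.lastRow × toℕ (π ⟨$⟩ˡ (π ⟨$⟩ʳ x₁)) < toℕ y₂
  x₁-kept = SW.NW-kept lastRow-NW (s≤s (≤-reflexive (row-π⁻¹ x₁)))
  x₁≤x₂ = proj₁ x₁-kept
  x₁<y₂ : toℕ x₁ < toℕ y₂
  x₁<y₂ = subst (_< toℕ y₂) (row-π⁻¹ x₁) (proj₂ x₁-kept)
  x₂<y₂ : toℕ x₂ < toℕ y₂
  x₂<y₂ = SW.lastRow-NW
  y₁-kept : toℕ SW.lastRow < toℕ firstCol × toℕ y₂ ≤ toℕ y₁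
  y₁-kept = SW.SE-kept ≤-refl firstCol-SE
  x₂<y₁ = proj₁ y₁-kept
  y₂≤y₁ = proj₂ y₁-kept

  northEastRook : ∃ λ N → toℕ N ≤ toℕ x₁ × toℕ firstCol ≤ col π N
  northEastRook =
    let a , a≤x₁ , j≤σa = exceeds⇒rook σ π (suc (toℕ lastRow)) (toℕ firstCol) exceeds
        c , c≤a , σa≤c = proj₂ (hull⇒rooks π hull a _ (covers a))
    in c , ≤-trans c≤a (≤-pred a≤x₁) , ≤-trans j≤σa σa≤c
  southWestRook : ∃ λ S → toℕ y₂ ≤ toℕ S × col π S ≤ toℕ SW.lastRow
  southWestRook =
    let b , b≤x₂ , y₂≤a = exceeds⇒rook (flip σ) (flip π) (suc (toℕ SW.lastRow)) (toℕ SW.firstCol) SW.exceeds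
        c , a≤c , c≤b = proj₁ (hull⇒rooks π hull (σ ⟨$⟩ˡ b) _ (covers (σ ⟨$⟩ˡ b)))
    in c , ≤-trans y₂≤a a≤c , ≤-trans c≤b (≤-trans (≤-reflexive (cong toℕ (inverseʳ σ))) (≤-pred b≤x₂))
  N = proj₁ northEastRook
  N≤x₁ = proj₁ (proj₂ northEastRook)
  y₁≤N = proj₂ (proj₂ northEastRook)
  S = proj₁ southWestRook
  y₂≤S = proj₁ (proj₂ southWestRook)
  S≤x₂ = proj₂ (proj₂ southWestRook)

exceeds⇒pattern : (π : Permutation′ n) {H : Matrix n} → IsRightHull π H → ∀ σ → Covers H σ →
  ∀ I J → I ≤ n → Exceeds σ π I J → ¬ AvoidsAll π
exceeds⇒pattern π hull σ covers I J I≤n e =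
  shrunkCorners⇒pattern σ π hull covers c
    (shrink (flip σ) (flip π) (toℕ firstCol) (suc (toℕ lastRow)) (<⇒≤ (toℕ<n firstCol))
      (exceeds-flip σ π (suc (toℕ lastRow)) (toℕ firstCol) exceeds))
  where
  c = shrink σ π I J I≤n e
  open ShrunkCorner c

avoids⇒interval : (π : Permutation′ n) {H : Matrix n} → IsRightHull π H → AvoidsAll π →
  ∀ σ → Covers H σ → σ ≤B π
avoids⇒interval π hull avoids σ covers i j = ≮⇒≥ λ r → exceeds⇒pattern π hull σ covers (suc (toℕ i)) (toℕ j) (toℕ<n i)
  (subst₂ _<_ (rankCount≡northEast π i j) (rankCount≡northEast σ i j) r) avoids

-- Rearranging the rooks of a pattern occurrence

module Extension (f : Fin k → Fin n) (f-injective : ∀ {a b} → f a ≡ f b → a ≡ b) where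

  image? : ∀ x → Dec (∃ λ a → f a ≡ x)
  image? x = any? λ a → f a Fin.≟ x

  extend : Permutation′ k → Fin n → Fin n
  extend τ x with image? x
  ... | yes (a , _) = f (τ ⟨$⟩ʳ a)
  ... | no _        = x

  extend-image : ∀ τ a → extend τ (f a) ≡ f (τ ⟨$⟩ʳ a)
  extend-image τ a with image? (f a)
  ... | yes (b , fb≡fa) = cong (λ c → f (τ ⟨$⟩ʳ c)) (f-injective fb≡fa)
  ... | no ∉            = contradiction (a , refl) ∉

  extend-other : ∀ τ x → ¬ (∃ λ a → f a ≡ x) → extend τ x ≡ x
  extend-other τ x ∉ with image? x
  ... | yes ∈ = contradiction ∈ ∉
  ... | no _  = refl

  extend-inverse : ∀ τ x → extend τ (extend (flip τ) x) ≡ x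
  extend-inverse τ x with image? x
  ... | yes (a , refl) = trans (extend-image τ _) (cong f (inverseʳ τ))
  ... | no ∉           = extend-other τ x ∉

  extendₚ : Permutation′ k → Permutation′ n
  extendₚ τ = permutation (extend τ) (extend (flip τ)) (extend-inverse τ) (extend-inverse (flip τ))

-- Replacing the pattern p by p ∘ τ keeps the rooks inside the hull of p,
-- but puts more of them weakly north-east of the cell in row c₀ and column p(e₀).
record Obstruction (p : Vec ℕ k) (τ : Permutation′ k) (c₀ e₀ : Fin k) : Set where
  constructor obstruction
  field
    hasSW     : ∀ c → ∃ λ d → toℕ c ≤ toℕ d × lookup p d ≤ lookup p (τ ⟨$⟩ʳ c)
    hasNE     : ∀ c → ∃ λ d → toℕ d ≤ toℕ c × lookup p (τ ⟨$⟩ʳ c) ≤ lookup p d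
    grows     : ∀ c → toℕ c ≤ toℕ c₀ → lookup p e₀ ≤ lookup p c → lookup p e₀ ≤ lookup p (τ ⟨$⟩ʳ c)
    before    : lookup p c₀ < lookup p e₀
    after     : lookup p e₀ ≤ lookup p (τ ⟨$⟩ʳ c₀)

obstruction? : (p : Vec ℕ k) (τ : Permutation′ k) (c₀ e₀ : Fin k) → Dec (Obstruction p τ c₀ e₀)
obstruction? p τ c₀ e₀ = map′
  (λ (a , b , c , d , e) → obstruction a b c d e) (λ (obstruction a b c d e) → a , b , c , d , e)
  ( (all? λ c → any? λ d → (toℕ c ≤? toℕ d) ×-dec (lookup p d ≤? lookup p (τ ⟨$⟩ʳ c)))
  ×-dec (all? λ c → any? λ d → (toℕ d ≤? toℕ c) ×-dec (lookup p (τ ⟨$⟩ʳ c) ≤? lookup p d))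
  ×-dec (all? λ c → (toℕ c ≤? toℕ c₀) →-dec (lookup p e₀ ≤? lookup p c) →-dec (lookup p e₀ ≤? lookup p (τ ⟨$⟩ʳ c)))
  ×-dec (lookup p c₀ <? lookup p e₀)
  ×-dec (lookup p e₀ ≤? lookup p (τ ⟨$⟩ʳ c₀)))

-- An occurrence preserves the order of positions and of values, so the conditions on `p` carry over
-- to `π`. Permuting only the occurrence's rooks by `τ` gives a `σ` covered by the hull, whose count
-- at row `f c₀` and the column of the rook in row `f e₀` is larger.
obstruction⇒avoids : (π : Permutation′ n) {H : Matrix n} → IsRightHull π H →
  {p : Vec ℕ k} {τ : Permutation′ k} {c₀ e₀ : Fin k} → Obstruction p τ c₀ e₀ →
  (∀ σ → Covers H σ → σ ≤B π) → Avoids π p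
obstruction⇒avoids {n} {k} π {H} hull {p} {τ} {c₀} {e₀} obs interval (f , f-mono , order) =
  <⇒≱ exceeds (subst₂ _≤_ (rankCount≡northEast σ i j) (rankCount≡northEast π i j) (interval σ covers i j))
  where
  open Obstruction obs

  f-injective : ∀ {a b} → f a ≡ f b → a ≡ b
  f-injective {a} {b} eq with <-cmp (toℕ a) (toℕ b)
  ... | tri< a<b _ _ = contradiction (f-mono a b a<b) (<-irrefl (cong toℕ eq))
  ... | tri≈ _ a≡b _ = toℕ-injective a≡b
  ... | tri> _ _ b<a = contradiction (f-mono b a b<a) (<-irrefl (cong toℕ (sym eq)))

  f-mono-≤ : ∀ {a b} → toℕ a ≤ toℕ b → toℕ (f a) ≤ toℕ (f b)
  f-mono-≤ {a} {b} a≤b with m≤n⇒m<n∨m≡n a≤b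
  ... | inj₁ a<b = <⇒≤ (f-mono a b a<b)
  ... | inj₂ a≡b = ≤-reflexive (cong (toℕ ∘ f) (toℕ-injective a≡b))

  f-cancel-≤ : ∀ {a b} → toℕ (f a) ≤ toℕ (f b) → toℕ a ≤ toℕ b
  f-cancel-≤ {a} {b} fa≤fb = ≮⇒≥ λ b<a → <⇒≱ (f-mono b a b<a) fa≤fb

  order-≤ : ∀ {a b} → lookup p a ≤ lookup p b → col π (f a) ≤ col π (f b)
  order-≤ {a} {b} pa≤pb = ≮⇒≥ λ πb<πa → <⇒≱ (Equivalence.to (order b a) πb<πa) pa≤pb

  order-cancel-≤ : ∀ {a b} → col π (f a) ≤ col π (f b) → lookup p a ≤ lookup p b
  order-cancel-≤ {a} {b} πa≤πb = ≮⇒≥ λ pb<pa → <⇒≱ (Equivalence.from (order b a) pb<pa) πa≤πb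

  open Extension f f-injective
  σ = extendₚ τ ∘ₚ π
  i = f c₀
  j = π ⟨$⟩ʳ f e₀

  covers : Covers H σ
  covers x = by-image (image? x)
    where
    by-image : Dec (∃ λ a → f a ≡ x) → H x (σ ⟨$⟩ʳ x) ≡ true
    by-image (no ∉) = subst (λ y → H x (π ⟨$⟩ʳ y) ≡ true) (sym (extend-other τ x ∉)) (proj₁ (proj₂ hull) x)
    by-image (yes (c , refl)) with hasSW c | hasNE c
    ... | d , c≤d , pd≤ | d' , d'≤c , ≤pd' = subst (λ y → H (f c) (π ⟨$⟩ʳ y) ≡ true) (sym (extend-image τ c))
      (rooks⇒hull π hull (f d , f-mono-≤ c≤d , order-≤ pd≤) (f d' , f-mono-≤ d'≤c , order-≤ ≤pd'))

  cell : Permutation′ n → Fin n → Bool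
  cell ρ a = below (suc (toℕ i)) a ∧ not (below (toℕ j) (ρ ⟨$⟩ʳ a))

  cell-intro : ∀ ρ a → toℕ a ≤ toℕ i → toℕ j ≤ col ρ a → T (cell ρ a)
  cell-intro ρ a a≤i j≤a = Equivalence.from T-∧ (below⁺ {m = suc (toℕ i)} (s≤s a≤i) , notBelow⁺ {m = toℕ j} j≤a)

  cell-elim : ∀ ρ a → T (cell ρ a) → toℕ a ≤ toℕ i × toℕ j ≤ col ρ a
  cell-elim ρ a t with Equivalence.to T-∧ t
  ... | u , v = ≤-pred (below⁻ {m = suc (toℕ i)} u) , notBelow⁻ v

  indicator-mono : ∀ {b c} → (T b → T c) → indicator b ≤ indicator c
  indicator-mono {true}  {true}  _   = ≤-refl
  indicator-mono {true}  {false} b⇒c = ⊥-elim (b⇒c _)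
  indicator-mono {false}         _   = z≤n

  indicator-strict : ∀ {b c} → ¬ T b → T c → indicator b < indicator c
  indicator-strict {true}          ¬b _ = contradiction _ ¬b
  indicator-strict {false} {true}  _  _ = s≤s z≤n

  pointwise : ∀ x → T (cell π x) → T (cell σ x)
  pointwise x t with cell-elim π x t
  ... | x≤i , j≤πx = cell-intro σ x x≤i (by-image (image? x))
    where
    by-image : Dec (∃ λ a → f a ≡ x) → toℕ j ≤ col σ x
    by-image (no ∉) = subst (λ y → toℕ j ≤ col π y) (sym (extend-other τ x ∉)) j≤πx
    by-image (yes (c , refl)) = subst (λ y → toℕ j ≤ col π y) (sym (extend-image τ c))
      (order-≤ (grows c (f-cancel-≤ x≤i) (order-cancel-≤ j≤πx)))

  exceeds : Exceeds σ π (suc (toℕ i)) (toℕ j)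
  exceeds = sum-mono-< (λ x → indicator-mono {cell π x} (pointwise x)) i
    (indicator-strict {cell π i}
      (λ t → <⇒≱ before (order-cancel-≤ (proj₂ (cell-elim π i t))))
      (cell-intro σ i ≤-refl (subst (λ y → toℕ j ≤ col π y) (sym (extend-image τ c₀)) (order-≤ after))))

-- The rearranged patterns are 4321, 15432, 43215 and 154326.
interval⇒avoids : (π : Permutation′ n) {H : Matrix n} → IsRightHull π H →
  (∀ σ → Covers H σ → σ ≤B π) → AvoidsAll π
interval⇒avoids π hull interval =
    -- The last two indices select the quadrant that gains a rook: here the rows up to position 1,
    -- counted from 0, and the values from 3 on. In all four cases the pattern has one entry there
    -- and its rearrangement two.
    obstruction⇒avoids π hull (from-yes (obstruction? p4231 (transpose (# 1) (# 2)) (# 1) (# 2))) interval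
  , obstruction⇒avoids π hull (from-yes (obstruction? p35142
      (transpose (# 0) (# 3) ∘ₚ transpose (# 2) (# 3)) (# 2) (# 3))) interval
  , obstruction⇒avoids π hull (from-yes (obstruction? p42513
      (transpose (# 1) (# 2) ∘ₚ transpose (# 2) (# 4)) (# 1) (# 4))) interval
  , obstruction⇒avoids π hull (from-yes (obstruction? p351624
      (transpose (# 0) (# 3) ∘ₚ transpose (# 2) (# 3) ∘ₚ transpose (# 3) (# 5)) (# 2) (# 5))) interval

theorem3p1 : (n : ℕ) → 1 ≤ n → (π : Permutation′ n) → (H : Matrix n) → IsRightHull π H →
    ((∀ (σ : Permutation′ n) → Covers H σ ⇔ σ ≤B π)
    ⇔ (Avoids π p4231 × Avoids π p35142 × Avoids π p42513 × Avoids π p351624))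
theorem3p1 n _ π H hull = mk⇔
  (λ equal → interval⇒avoids π hull λ σ → Equivalence.to (equal σ))
  (λ avoids σ → mk⇔ (avoids⇒interval π hull avoids σ) (≤B⇒covers π hull σ))
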